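{- Let $k,n$ be positive integers and let $i$ be an integer with $0\le i<k$. In the maximum-strip case, the number of good paths is $$\frac{n(k-i)(k+1-i)}{(kn+n-1-i)(kn+n-i)}\binom{kn+n-i}{n}.$$
   Context: All paths are lattice paths in $\mathbb{Z}^2$ composed only of unit steps to the right $(1,0)$ and up $(0,1)$. Fix positive integers $k,n$ and an integer $i$ with $0\le i<k$. For a point $(x,y)$ let $d((x,y))=ky-x$, the signed horizontal distance from $(x,y)$ to the line $y=x/k$. In the maximum-strip case, the strip consists of all lattice points $p\notin\{(0,0),(kn-i,n)\}$ such that $0\le d(p)<i$, together with all lattice points in the interior of the upper boundary, i.e. all lattice points $p=(x,y)$ with $d(p)=i$ and $0<y<n$. Points in the strip are called forbidden. A good path is a path from $(0,0)$ to $(kn-i,n)$ that avoids all forbidden points. -}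

module Defs where

open import Data.Integer.Base as ℤ using (ℤ; +_; 0ℤ; 1ℤ)
open import Data.List.Base using (List; []; _∷_; length)
open import Data.List.Membership.Propositional using (_∈_)
open import Data.List.Relation.Unary.All using (All)
open import Data.List.Relation.Unary.Unique.Propositional using (Unique)
open import Data.Nat.Base using (ℕ; suc; _+_; _*_; _∸_; _<_; NonZero; >-nonZero)
open import Data.Nat.Properties
  using (m*n≢0; m<n⇒0<n∸m; <-≤-trans; ≤-trans; m∸n≤m; +-suc; m≤m*n; m≤m+n)
open import Data.Product.Base using (_×_; _,_; proj₂; ∃-syntax)
open import Data.Sum.Base using (_⊎_)
open import Function.Bundles using (_⇔_)
open import Relation.Binary.PropositionalEquality using (_≡_; _≢_; cong; subst; sym)
open import Relation.Nullary.Negation.Core using (¬_)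

Point : Set
Point = ℤ × ℤ

origin : Point
origin = 0ℤ , 0ℤ

data Step : Set where
  right up : Step

move : Step → Point → Point
move right (x , y) = x ℤ.+ 1ℤ , y
move up    (x , y) = x , y ℤ.+ 1ℤ

-- A lattice path with a given starting point is encoded by its list of steps.
Path : Set
Path = List Step

endpoint : Point → Path → Point
endpoint p []      = p
endpoint p (s ∷ w) = endpoint (move s p) w

-- All lattice points on the path, both ends included.
points : Point → Path → List Point
points p []      = p ∷ []
points p (s ∷ w) = p ∷ points (move s p) w

module _ (k n i : ℕ) where

  d : Point → ℤ
  d (x , y) = + k ℤ.* y ℤ.- x

  target : Point
  target = + k ℤ.* + n ℤ.- + i , + n

  Forbidden : Point → Set
  Forbidden p =
      (p ≢ origin × p ≢ target × 0ℤ ℤ.≤ d p × d p ℤ.< + i)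
    ⊎ (d p ≡ + i × 0ℤ ℤ.< proj₂ p × proj₂ p ℤ.< + n)

  GoodPath : Path → Set
  GoodPath w = endpoint origin w ≡ target
             × All (λ p → ¬ Forbidden p) (points origin w)

-- Exactly N elements satisfy P: the list xs contains each of them exactly once
-- and nothing else.
HasCount : {A : Set} → (A → Set) → ℕ → Set
HasCount {A} P N =
  ∃[ xs ] Unique {A = A} xs × (∀ x → x ∈ xs ⇔ P x) × length xs ≡ N

-- For k, n > 0 and i < k the truncated subtractions below never truncate, and
-- both factors are positive.
denominator : ℕ → ℕ → ℕ → ℕ
denominator k n i = (k * n + n ∸ 1 ∸ i) * (k * n + n ∸ i)

denominator-nonZero : ∀ k n i → 0 < k → 0 < n → i < k → NonZero (denominator k n i)
denominator-nonZero k (suc m) i _ _ i<k =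
  m*n≢0 (k * suc m + suc m ∸ 1 ∸ i) (k * suc m + suc m ∸ i)
    {{>-nonZero (m<n⇒0<n∸m i<pred)}}
    {{>-nonZero (m<n⇒0<n∸m (<-≤-trans i<pred (m∸n≤m (k * suc m + suc m) 1)))}}
  where
  i<pred : i < k * suc m + suc m ∸ 1
  i<pred = subst (i <_) (sym (cong (_∸ 1) (+-suc (k * suc m) m)))
    (<-≤-trans i<k (≤-trans (m≤m*n k (suc m)) (m≤m+n (k * suc m) m)))

{-# OPTIONS --safe #-}
module Submission where

-- A good path stays strictly below the line d = 0 after the origin, crosses the
-- strip in a single up step, and then stays strictly beyond the line d = i until
-- it reaches the target. Read backwards, the part before the crossing starts at
-- some height a = -d and first reaches 0 at its end; the part after it does the
-- same from the height b = d - i, and the crossing forces a + b = k - i. Let F(h, u)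
-- be the number of walks with u up steps (right: -1, up: +k) from height h that
-- first reach 0 at their end. Cutting such a walk at its first visit to an
-- intermediate height gives F(a, .) * F(b, .) = F(a + b, .) under convolution.
-- Hence each of the k - i + 1 pairs (a, b) contributes F(k - i, n - 1), which the
-- ballot formula F(h, u) = h / L * binom(L, u), L = (k + 1) u + h, evaluates.

open import Defs
open import Data.Empty using (⊥; ⊥-elim)
open import Data.Integer.Base as ℤ using (+_; -[1+_])
import Data.Integer.Properties as ℤ
open import Data.List.Base using (List; []; _∷_; [_]; _++_; _ʳ++_; concatMap; length; map; reverse)
open import Data.List.Membership.Propositional using (_∈_; find; lose)
open import Data.List.Membership.Propositional.Properties
  using (∈-map⁺; ∈-map⁻; ∈-++⁺ˡ; ∈-++⁺ʳ; ∈-++⁻; ∈-concatMap⁺; ∈-concatMap⁻)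
open import Data.List.Properties
  using (length-++; length-map; map-∘; map-cong; ∷-injectiveˡ; ∷-injectiveʳ; ++-ʳ++;
         ++-cancelˡ; ʳ++-defn; reverse-involutive)
open import Data.List.Relation.Unary.All as All using (All; []; _∷_)
open import Data.List.Relation.Unary.AllPairs using ([]; _∷_)
open import Data.List.Relation.Unary.Any using (here; there)
open import Data.List.Relation.Unary.Unique.Propositional using (Unique)
open import Data.List.Relation.Unary.Unique.Propositional.Properties using (map⁺; ++⁺)
open import Data.Nat.Base using (ℕ; zero; suc; _+_; _*_; _∸_; _<_; _≤_; z≤n; z<s; NonZero)
open import Data.Nat.Combinatorics using (_C_; nCk+nC[k+1]≡[n+1]C[k+1]; nC1≡n)
open import Data.Nat.ListAction using (sum)
open import Data.Nat.Properties
open import Data.Nat.Tactic.RingSolver using (solve-∀)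
open import Data.Product.Base using (_×_; _,_; proj₁; proj₂; ∃-syntax; map₁)
open import Data.Product.Properties using (,-injectiveˡ; ,-injectiveʳ)
open import Data.Rational.Base as ℚ using (_/_)
import Data.Rational.Properties as ℚ
open import Data.Rational.Unnormalised.Base as ℚᵘ using (mkℚᵘ; *≡*)
import Data.Rational.Unnormalised.Properties as ℚᵘ
open import Data.Sum.Base using (_⊎_; inj₁; inj₂)
open import Function.Base using (_∘_)
open import Function.Bundles using (mk⇔)
open import Relation.Binary.PropositionalEquality
  using (_≡_; refl; sym; trans; cong; cong₂; subst; module ≡-Reasoning)
open import Relation.Nullary using (¬_; Dec; yes; no)

private variable
  A B : Set

-- Finite lists: duplicate-freeness, lengths, antidiagonals and factorizations.

concatMap-unique : ∀ {f : A → List B} {xs} → Unique xs → (∀ {x} → x ∈ xs → Unique (f x)) →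
  (∀ {x x′ y} → x ∈ xs → x′ ∈ xs → y ∈ f x → y ∈ f x′ → x ≡ x′) →
  Unique (concatMap f xs)
concatMap-unique [] _ _ = []
concatMap-unique {f = f} {x ∷ xs} (x∉xs ∷ xs!) f! disj = ++⁺ (f! (here refl))
  (concatMap-unique xs! (f! ∘ there) (λ p q → disj (there p) (there q))) λ (y∈fx , y∈rest) →
    let x′ , x′∈xs , y∈fx′ = find (∈-concatMap⁻ f {xs = xs} y∈rest)
    in All.lookup x∉xs x′∈xs (disj (here refl) (there x′∈xs) y∈fx y∈fx′)

length-concatMap : ∀ (f : A → List B) xs →
  length (concatMap f xs) ≡ sum (map (length ∘ f) xs)
length-concatMap f []       = refl
length-concatMap f (x ∷ xs) =
  trans (length-++ (f x)) (cong (_+_ (length (f x))) (length-concatMap f xs))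

sum-const : ∀ (f : A → ℕ) {s xs} → All (λ x → f x ≡ s) xs → sum (map f xs) ≡ length xs * s
sum-const f []         = refl
sum-const f (eq ∷ eqs) = cong₂ _+_ eq (sum-const f eqs)

sum-+ : ∀ (f g : A → ℕ) xs → sum (map (λ x → f x + g x) xs) ≡ sum (map f xs) + sum (map g xs)
sum-+ f g []       = refl
sum-+ f g (x ∷ xs) rewrite sum-+ f g xs = lemma (f x) (g x) _ _
  where
  lemma : ∀ a b c d → a + b + (c + d) ≡ a + c + (b + d)
  lemma = solve-∀

antidiagonal : ℕ → List (ℕ × ℕ)
antidiagonal zero    = [ (0 , 0) ]
antidiagonal (suc s) = (0 , suc s) ∷ map (map₁ suc) (antidiagonal s)

antidiagonal-unique : ∀ s → Unique (antidiagonal s)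
antidiagonal-unique zero    = [] ∷ []
antidiagonal-unique (suc s) =
  All.tabulate (λ p∈ eq → let _ , _ , eq′ = ∈-map⁻ (map₁ suc) p∈ in 0≢1+n (cong proj₁ (trans eq eq′)))
  ∷ map⁺ (λ eq → cong₂ _,_ (suc-injective (,-injectiveˡ eq)) (,-injectiveʳ eq)) (antidiagonal-unique s)

∈-antidiagonal⁺ : ∀ a b → (a , b) ∈ antidiagonal (a + b)
∈-antidiagonal⁺ zero    zero    = here refl
∈-antidiagonal⁺ zero    (suc b) = here refl
∈-antidiagonal⁺ (suc a) b       = there (∈-map⁺ (map₁ suc) (∈-antidiagonal⁺ a b))

∈-antidiagonal⁻ : ∀ s {p} → p ∈ antidiagonal s → proj₁ p + proj₂ p ≡ s
∈-antidiagonal⁻ zero    (here refl) = refl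
∈-antidiagonal⁻ (suc s) (here refl) = refl
∈-antidiagonal⁻ (suc s) (there p∈) with ∈-map⁻ (map₁ suc) p∈
... | _ , q∈ , refl = cong suc (∈-antidiagonal⁻ s q∈)

length-antidiagonal : ∀ s → length (antidiagonal s) ≡ suc s
length-antidiagonal zero    = refl
length-antidiagonal (suc s) =
  cong suc (trans (length-map _ (antidiagonal s)) (length-antidiagonal s))

-- Of two left factors of one list, the shorter is a prefix of the longer. This compares two
-- candidate crossings of one path.
++-split : ∀ (ws xs : List A) {ys zs} → ws ++ ys ≡ xs ++ zs →
  (∃[ vs ] xs ≡ ws ++ vs × ys ≡ vs ++ zs) ⊎ (∃[ vs ] ws ≡ xs ++ vs × zs ≡ vs ++ ys)
++-split []       xs       eq = inj₁ (xs , refl , eq)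
++-split (w ∷ ws) []       eq = inj₂ (w ∷ ws , refl , sym eq)
++-split (w ∷ ws) (x ∷ xs) eq with ∷-injectiveˡ eq | ++-split ws xs (∷-injectiveʳ eq)
... | refl | inj₁ (vs , eq₁ , eq₂) = inj₁ (vs , cong (w ∷_) eq₁ , eq₂)
... | refl | inj₂ (vs , eq₁ , eq₂) = inj₂ (vs , cong (w ∷_) eq₁ , eq₂)

-- The absorption identity for binomial coefficients.

C-absorb : ∀ n j → suc j * (suc n C suc j) ≡ suc n * (n C j)
C-absorb n       zero    = trans (*-identityˡ _) (trans (nC1≡n (suc n)) (sym (*-identityʳ (suc n))))
C-absorb zero    (suc j) = *-zeroʳ (suc (suc j))
C-absorb (suc n) (suc j) = begin
  suc (suc j) * (suc (suc n) C suc (suc j))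
    ≡⟨ cong (suc (suc j) *_) (nCk+nC[k+1]≡[n+1]C[k+1] (suc n) (suc j)) ⟨
  suc (suc j) * (x + suc n C suc (suc j))
    -- One copy of `x` is set aside so that each remaining product is the left side of an induction
    -- hypothesis.
    ≡⟨ lemma₁ j x _ ⟩
  x + (suc j * x + suc (suc j) * (suc n C suc (suc j)))
    ≡⟨ cong (_+_ x) (cong₂ _+_ (C-absorb n j) (C-absorb n (suc j))) ⟩
  x + (suc n * (n C j) + suc n * (n C suc j))
    ≡⟨ cong (_+_ x) (*-distribˡ-+ (suc n) (n C j) (n C suc j)) ⟨
  x + suc n * (n C j + n C suc j)
    ≡⟨ cong (λ t → x + suc n * t) (nCk+nC[k+1]≡[n+1]C[k+1] n j) ⟩
  suc (suc n) * x ∎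
  where
  open ≡-Reasoning
  x = suc n C suc j
  lemma₁ : ∀ j x y → (2 + j) * (x + y) ≡ x + ((1 + j) * x + (2 + j) * y)
  lemma₁ = solve-∀

-- Descents and their enumeration.

module _ (k : ℕ) where

  -- Indexed by the starting height and the number of up steps: right lowers the
  -- height by one, up raises it by k, and it is positive until it is 0 at the end.
  data Descent : ℕ → ℕ → Path → Set where
    stop  : Descent 0 0 []
    right : ∀ {h u w} → Descent h u w → Descent (suc h) u (right ∷ w)
    up    : ∀ {h u w} → Descent (suc h + k) u w → Descent (suc h) (suc u) (up ∷ w)

  -- Recursion on the first step. It terminates lexicographically: an up step raises the height but
  -- uses up one of the `u` up steps.
  descents : ℕ → ℕ → List Path
  descents zero    zero    = [ [] ]
  descents zero    (suc u) = []
  descents (suc h) zero    = map (right ∷_) (descents h zero)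
  descents (suc h) (suc u) =
    map (right ∷_) (descents h (suc u)) ++ map (up ∷_) (descents (suc h + k) u)

  ∈-descents⁺ : ∀ {h u w} → Descent h u w → w ∈ descents h u
  ∈-descents⁺ stop                = here refl
  ∈-descents⁺ {u = zero} (right D) = ∈-map⁺ _ (∈-descents⁺ D)
  ∈-descents⁺ {u = suc u} (right D) = ∈-++⁺ˡ (∈-map⁺ _ (∈-descents⁺ D))
  ∈-descents⁺ {suc h} {suc u} (up D) =
    ∈-++⁺ʳ (map (right ∷_) (descents h (suc u))) (∈-map⁺ _ (∈-descents⁺ D))

  ∈-descents⁻ : ∀ h u {w} → w ∈ descents h u → Descent h u w
  ∈-descents⁻ zero    zero    (here refl) = stop
  ∈-descents⁻ (suc h) zero    w∈ with ∈-map⁻ _ w∈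
  ... | _ , w′∈ , refl = right (∈-descents⁻ h zero w′∈)
  ∈-descents⁻ (suc h) (suc u) w∈ with ∈-++⁻ (map (right ∷_) (descents h (suc u))) w∈
  ... | inj₁ w∈ʳ with ∈-map⁻ _ w∈ʳ
  ...   | _ , w′∈ , refl = right (∈-descents⁻ h (suc u) w′∈)
  ∈-descents⁻ (suc h) (suc u) w∈ | inj₂ w∈ᵘ with ∈-map⁻ _ w∈ᵘ
  ...   | _ , w′∈ , refl = up (∈-descents⁻ (suc h + k) u w′∈)

  descents-unique : ∀ h u → Unique (descents h u)
  descents-unique zero    zero    = [] ∷ []
  descents-unique zero    (suc u) = []
  descents-unique (suc h) zero    = map⁺ ∷-injectiveʳ (descents-unique h zero)
  descents-unique (suc h) (suc u) =
    ++⁺ (map⁺ ∷-injectiveʳ (descents-unique h (suc u)))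
        (map⁺ ∷-injectiveʳ (descents-unique (suc h + k) u))
        λ (w∈ʳ , w∈ᵘ) → disjoint (∈-map⁻ _ w∈ʳ) (∈-map⁻ _ w∈ᵘ)
    where
    disjoint : ∀ {w vs vs′} → ∃[ v ] v ∈ vs × w ≡ right ∷ v → ∃[ v ] v ∈ vs′ × w ≡ up ∷ v → ⊥
    disjoint (_ , _ , refl) (_ , _ , ())

  -- Ballot numbers: recursion, convolution and closed form.

  ballot : ℕ → ℕ → ℕ
  ballot zero    zero    = 1
  ballot zero    (suc u) = 0
  ballot (suc h) zero    = ballot h zero
  ballot (suc h) (suc u) = ballot h (suc u) + ballot (suc h + k) u

  length-descents : ∀ h u → length (descents h u) ≡ ballot h u
  length-descents zero    zero    = refl
  length-descents zero    (suc u) = refl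
  length-descents (suc h) zero    = trans (length-map _ (descents h zero)) (length-descents h zero)
  length-descents (suc h) (suc u) = trans
    (length-++ (map (right ∷_) (descents h (suc u))))
    (cong₂ _+_
      (trans (length-map _ (descents h (suc u))) (length-descents h (suc u)))
      (trans (length-map _ (descents (suc h + k) u)) (length-descents (suc h + k) u)))

  ballot² : ℕ → ℕ → ℕ × ℕ → ℕ
  ballot² a b (u , v) = ballot a u * ballot b v

  -- The first-step recursion is applied to the left factor, by induction on `s` and then on `a`.
  -- From height 0 only the empty walk exists, so a single term survives.
  ballot-convolution : ∀ a b s → sum (map (ballot² a b) (antidiagonal s)) ≡ ballot (a + b) s
  ballot-convolution zero    b zero    = trans (+-identityʳ _) (*-identityˡ _)
  ballot-convolution zero    b (suc s) = begin
    1 * ballot b (suc s) + sum (map (ballot² 0 b) (map (map₁ suc) (antidiagonal s)))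
      ≡⟨ cong₂ _+_ (*-identityˡ _) (cong sum (sym (map-∘ (antidiagonal s)))) ⟩
    ballot b (suc s) + sum (map (λ _ → 0) (antidiagonal s))
      ≡⟨ cong (_+_ (ballot b (suc s))) (sum-const (λ _ → 0) {xs = antidiagonal s} (All.tabulate λ _ → refl)) ⟩
    ballot b (suc s) + length (antidiagonal s) * 0
      ≡⟨ cong (_+_ (ballot b (suc s))) (*-zeroʳ (length (antidiagonal s))) ⟩
    ballot b (suc s) + 0
      ≡⟨ +-identityʳ _ ⟩
    ballot b (suc s) ∎
    where open ≡-Reasoning
  ballot-convolution (suc a) b zero    = ballot-convolution a b zero
  ballot-convolution (suc a) b (suc s) = begin
    first + sum (map (ballot² (suc a) b) (map (map₁ suc) (antidiagonal s)))
      ≡⟨ cong (λ t → first + sum t) (trans (sym (map-∘ (antidiagonal s)))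
           (map-cong (λ (u , v) → *-distribʳ-+ (ballot b v) (ballot a (suc u)) _) (antidiagonal s))) ⟩
    first + sum (map (λ p → ballot² a b (map₁ suc p) + ballot² (suc a + k) b p) (antidiagonal s))
      ≡⟨ cong (_+_ first) (sum-+ (ballot² a b ∘ map₁ suc) (ballot² (suc a + k) b) (antidiagonal s)) ⟩
    first + (sum (map (ballot² a b ∘ map₁ suc) (antidiagonal s)) + sum (map (ballot² (suc a + k) b) (antidiagonal s)))
      ≡⟨ +-assoc first _ _ ⟨
    first + sum (map (ballot² a b ∘ map₁ suc) (antidiagonal s)) + sum (map (ballot² (suc a + k) b) (antidiagonal s))
      ≡⟨ cong₂ _+_ (cong (λ t → first + sum t) (map-∘ (antidiagonal s))) (ballot-convolution (suc a + k) b s) ⟩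
    -- The term `first`, where the left factor has no up step, unfolds to height `a` unchanged; with
    -- the shifted terms it restores the full antidiagonal sum.
    sum (map (ballot² a b) (antidiagonal (suc s))) + ballot (suc a + k + b) s
      ≡⟨ cong₂ _+_ (ballot-convolution a b (suc s)) (cong (λ h → ballot h s) (swap a k b)) ⟩
    ballot (a + b) (suc s) + ballot (suc (a + b) + k) s ∎
    where
    open ≡-Reasoning
    first = ballot a 0 * ballot b (suc s)
    swap : ∀ a k b → suc a + k + b ≡ suc (a + b) + k
    swap = solve-∀

  -- The factor `suc k * u + h` is the length of every such walk: u up steps, and h + k u right
  -- steps to bring the height to 0. Multiplying by it keeps the ballot formula in the naturals.
  ballot-closed : ∀ h u →
    ballot h u * (suc k * u + h) ≡ h * ((suc k * u + h) C u)
  ballot-closed zero    zero    = trans (*-identityˡ _) (trans (+-identityʳ _) (*-zeroʳ (suc k)))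
  ballot-closed zero    (suc u) = refl
  ballot-closed (suc h) zero    rewrite *-zeroʳ (suc k) =
    trans (cong (_* suc h) (ballot-zero h)) (*-comm 1 (suc h))
    where
    ballot-zero : ∀ h → ballot h 0 ≡ 1
    ballot-zero zero    = refl
    ballot-zero (suc h) = ballot-zero h

  -- Compared after multiplying by M and adding (1 + k) (1 + u) (M + 1 C u + 1), which
  -- equals (1 + k) (M + 1) (M C u); what remains is a semiring identity.
  ballot-closed (suc h) (suc u) =
    subst (λ t → (F₁ + F₂) * t ≡ suc h * (t C suc u)) (sym (+-suc (suc k * suc u) h))
      (subst (λ t → (F₁ + F₂) * suc M ≡ suc h * t) (nCk+nC[k+1]≡[n+1]C[k+1] M u)
        (*-cancelˡ-≡ _ _ M (+-cancelʳ-≡ (suc k * (suc M * X)) _ _ (begin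
          M * ((F₁ + F₂) * suc M) + suc k * (suc M * X)
            ≡⟨ cong₂ _+_ (distribute M F₁ F₂) (cong (suc k *_) (sym absorb)) ⟩
          (F₁ * M + F₂ * M) * suc M + suc k * (suc u * (X + X′))
            ≡⟨ cong (λ t → t * suc M + suc k * (suc u * (X + X′))) (cong₂ _+_ (ballot-closed h (suc u)) F₂-closed) ⟩
          (h * X′ + (suc h + k) * X) * suc M + suc k * (suc u * (X + X′))
            ≡⟨ identity k u h X X′ ⟩
          M * (suc h * (X + X′)) + suc k * (suc M * X) ∎))))
    where
    open ≡-Reasoning
    M F₁ F₂ X X′ : ℕ
    M = suc k * suc u + h
    F₁ = ballot h (suc u)
    F₂ = ballot (suc h + k) u
    X = M C u
    X′ = M C suc u
    -- Both continuations after the first step have the same length `M`, so both induction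
    -- hypotheses concern row `M` of Pascal's triangle.
    shift : ∀ k u h → suc k * u + (suc h + k) ≡ suc k * suc u + h
    shift = solve-∀
    F₂-closed : F₂ * M ≡ (suc h + k) * X
    F₂-closed = subst (λ t → F₂ * t ≡ (suc h + k) * (t C u)) (shift k u h) (ballot-closed (suc h + k) u)
    absorb : suc u * (X + X′) ≡ suc M * X
    absorb = trans (cong (suc u *_) (nCk+nC[k+1]≡[n+1]C[k+1] M u)) (C-absorb M u)
    distribute : ∀ m f g → m * ((f + g) * suc m) ≡ (f * m + g * m) * suc m
    distribute = solve-∀
    identity : ∀ k u h x y →
      (h * y + (suc h + k) * x) * suc (suc k * suc u + h) + suc k * (suc u * (x + y)) ≡
      (suc k * suc u + h) * (suc h * (x + y)) + suc k * (suc (suc k * suc u + h) * x)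
    identity = solve-∀

  -- Recovering the crossing from a path.

  Descent-functional : ∀ {h h′ u u′ w} → Descent h u w → Descent h′ u′ w → h ≡ h′ × u ≡ u′
  Descent-functional stop      stop       = refl , refl
  Descent-functional (right D) (right D′) with Descent-functional D D′
  ... | refl , refl = refl , refl
  Descent-functional (up D)    (up D′)    with Descent-functional D D′
  ... | eq , refl = +-cancelʳ-≡ k _ _ eq , refl

  Descent-suffix : ∀ vs {w h u} → Descent h u (vs ʳ++ w) → ∃[ h′ ] ∃[ u′ ] Descent h′ u′ w
  Descent-suffix []       D = _ , _ , D
  Descent-suffix (v ∷ vs) D with Descent-suffix vs D
  ... | _ , _ , right D′ = _ , _ , D′
  ... | _ , _ , up D′    = _ , _ , D′

  -- An up step of a descent starts at positive height, so it ends above height k.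
  Descent-not-after-up : ∀ vs {a a′ u u′ w} → a ≤ k → Descent a u w → Descent a′ u′ (vs ʳ++ up ∷ w) → ⊥
  Descent-not-after-up vs a≤k D D′ with Descent-suffix vs D′
  ... | _ , _ , up {h} D″ with Descent-functional D D″
  ...   | refl , _ = m+n≮n h k a≤k

  -- Since first parts are stored backwards, a prefix of a traversed part becomes a suffix of the
  -- stored descent.
  ++-reverse : ∀ vs vs′ {w : Path} → reverse vs′ ≡ reverse vs ++ w → vs′ ≡ w ʳ++ vs
  ++-reverse vs vs′ {w} eq = begin
    vs′                          ≡⟨ reverse-involutive vs′ ⟨
    reverse (reverse vs′)        ≡⟨ cong reverse eq ⟩
    (reverse vs ++ w) ʳ++ []     ≡⟨ ++-ʳ++ (reverse vs) ⟩
    w ʳ++ reverse (reverse vs)   ≡⟨ cong (w ʳ++_) (reverse-involutive vs) ⟩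
    w ʳ++ vs                     ∎
    where open ≡-Reasoning

  -- The first part is stored backwards, from the crossing to the origin.
  join : Path → Path → Path
  join v w = v ʳ++ up ∷ w

  join-injectiveʳ : ∀ v {w w′} → join v w ≡ join v w′ → w ≡ w′
  join-injectiveʳ v eq =
    ∷-injectiveʳ (++-cancelˡ (reverse v) _ _ (trans (sym (ʳ++-defn v)) (trans eq (ʳ++-defn v))))

  -- If the two crossings differed, the longer first part would contain the up step that ends the
  -- shorter one. Its stored form would then contain the shorter descent right after an up step,
  -- although that descent starts at height at most `k`.
  join-injectiveˡ : ∀ {a a′ u u′ v v′ w w′} → a ≤ k → a′ ≤ k →
    Descent a u v → Descent a′ u′ v′ → join v w ≡ join v′ w′ → v ≡ v′
  join-injectiveˡ {v = v} {v′} a≤k a′≤k D D′ eq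
    with ++-split (reverse v) (reverse v′) (trans (sym (ʳ++-defn v)) (trans eq (ʳ++-defn v′)))
  ... | inj₁ ([] , eq₁ , _)      = sym (++-reverse v v′ eq₁)
  ... | inj₂ ([] , eq₁ , _)      = ++-reverse v′ v eq₁
  ... | inj₁ (up ∷ vs , eq₁ , refl) =
    ⊥-elim (Descent-not-after-up vs a≤k D (subst (Descent _ _) (++-reverse v v′ eq₁) D′))
  ... | inj₂ (up ∷ vs , eq₁ , refl) =
    ⊥-elim (Descent-not-after-up vs a′≤k D′ (subst (Descent _ _) (++-reverse v′ v eq₁) D))

  -- Enumeration of the paths with a crossing.

  data Joined (c m : ℕ) : Path → Set where
    -- In the application `c` is k - i and `m` is n - 1: the crossing itself is the one up step not
    -- counted in `u + v`.
    joined : ∀ {a b u v A B} → a + b ≡ c → u + v ≡ m → Descent a u A → Descent b v B →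
             Joined c m (join A B)

  joinsAfter : ℕ → ℕ → Path → List Path
  joinsAfter b v A = map (join A) (descents b v)

  joinsAt : ℕ × ℕ → ℕ × ℕ → List Path
  joinsAt (a , b) (u , v) = concatMap (joinsAfter b v) (descents a u)

  joinsOver : ℕ → ℕ × ℕ → List Path
  joinsOver m ab = concatMap (joinsAt ab) (antidiagonal m)

  joins : ℕ → ℕ → List Path
  joins c m = concatMap (joinsOver m) (antidiagonal c)

  ∈-joinsAt⁻ : ∀ ab uv {w} → w ∈ joinsAt ab uv →
    ∃[ A ] ∃[ B ] Descent (proj₁ ab) (proj₁ uv) A × Descent (proj₂ ab) (proj₂ uv) B × w ≡ join A B
  ∈-joinsAt⁻ (a , b) (u , v) w∈ with find (∈-concatMap⁻ (joinsAfter b v) {xs = descents a u} w∈)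
  ... | A , A∈ , w∈A with ∈-map⁻ _ w∈A
  ...   | B , B∈ , refl = A , B , ∈-descents⁻ a u A∈ , ∈-descents⁻ b v B∈ , refl

  ∈-joinsOver⁻ : ∀ m ab {w} → w ∈ joinsOver m ab → ∃[ uv ] uv ∈ antidiagonal m × w ∈ joinsAt ab uv
  ∈-joinsOver⁻ m ab w∈ = find (∈-concatMap⁻ (joinsAt ab) {xs = antidiagonal m} w∈)

  ∈-joins⁻ : ∀ c m {w} → w ∈ joins c m → Joined c m w
  ∈-joins⁻ c m w∈ with find (∈-concatMap⁻ (joinsOver m) {xs = antidiagonal c} w∈)
  ... | ab , ab∈ , w∈ab with ∈-joinsOver⁻ m ab w∈ab
  ...   | uv , uv∈ , w∈uv with ∈-joinsAt⁻ ab uv w∈uv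
  ...     | A , B , D , D′ , refl = joined (∈-antidiagonal⁻ c ab∈) (∈-antidiagonal⁻ m uv∈) D D′

  ∈-joins⁺ : ∀ {c m w} → Joined c m w → w ∈ joins c m
  ∈-joins⁺ {c} {m} (joined {a} {b} {u} {v} {A} refl refl D D′) =
    ∈-concatMap⁺ (joinsOver m) {xs = antidiagonal c} (lose (∈-antidiagonal⁺ a b)
      (∈-concatMap⁺ (joinsAt (a , b)) {xs = antidiagonal m} (lose (∈-antidiagonal⁺ u v)
        (∈-concatMap⁺ (joinsAfter b v) {xs = descents a u} (lose (∈-descents⁺ D)
          (∈-map⁺ (join A) (∈-descents⁺ D′)))))))

  -- The path fixes its crossing and hence both parts; each part, read from its end at height 0,
  -- fixes its starting height and its number of up steps.
  joinsAt-functional : ∀ ab ab′ uv uv′ {w} → proj₁ ab ≤ k → proj₁ ab′ ≤ k →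
    w ∈ joinsAt ab uv → w ∈ joinsAt ab′ uv′ → ab ≡ ab′ × uv ≡ uv′
  joinsAt-functional ab ab′ uv uv′ a≤k a′≤k w∈ w∈′ with ∈-joinsAt⁻ ab uv w∈ | ∈-joinsAt⁻ ab′ uv′ w∈′
  ... | A , B , DA , DB , eq | _ , _ , DA′ , DB′ , eq′
    with trans (sym eq) eq′
  ... | eq″ with join-injectiveˡ a≤k a′≤k DA DA′ eq″
  ... | refl with join-injectiveʳ A eq″
  ... | refl with Descent-functional DA DA′ | Descent-functional DB DB′
  ... | refl , refl | refl , refl = refl , refl

  joins-unique : ∀ {c} m → c ≤ k → Unique (joins c m)
  joins-unique {c} m c≤k = concatMap-unique (antidiagonal-unique c) over-unique disjoint
    where
    bound : ∀ {ab} → ab ∈ antidiagonal c → proj₁ ab ≤ k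
    bound ab∈ = ≤-trans (m+n≤o⇒m≤o _ (≤-reflexive (∈-antidiagonal⁻ c ab∈))) c≤k

    disjoint : ∀ {ab ab′ w} → ab ∈ antidiagonal c → ab′ ∈ antidiagonal c →
      w ∈ joinsOver m ab → w ∈ joinsOver m ab′ → ab ≡ ab′
    disjoint {ab} {ab′} ab∈ ab′∈ w∈ w∈′ with ∈-joinsOver⁻ m ab w∈ | ∈-joinsOver⁻ m ab′ w∈′
    ... | uv , _ , w∈uv | uv′ , _ , w∈uv′ =
      proj₁ (joinsAt-functional ab ab′ uv uv′ (bound ab∈) (bound ab′∈) w∈uv w∈uv′)

    over-unique : ∀ {ab} → ab ∈ antidiagonal c → Unique (joinsOver m ab)
    over-unique {a , b} ab∈ = concatMap-unique (antidiagonal-unique m) at-unique disjoint′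
      where
      disjoint′ : ∀ {uv uv′ w} → uv ∈ antidiagonal m → uv′ ∈ antidiagonal m →
        w ∈ joinsAt (a , b) uv → w ∈ joinsAt (a , b) uv′ → uv ≡ uv′
      disjoint′ {uv} {uv′} _ _ w∈ w∈′ =
        proj₂ (joinsAt-functional (a , b) (a , b) uv uv′ (bound ab∈) (bound ab∈) w∈ w∈′)

      at-unique : ∀ {uv} → uv ∈ antidiagonal m → Unique (joinsAt (a , b) uv)
      at-unique {u , v} _ = concatMap-unique (descents-unique a u)
        (λ {A} _ → map⁺ (join-injectiveʳ A) (descents-unique b v))
        disjoint″
        where
        disjoint″ : ∀ {A A′ w} → A ∈ descents a u → A′ ∈ descents a u →
          w ∈ joinsAfter b v A → w ∈ joinsAfter b v A′ → A ≡ A′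
        disjoint″ {A} {A′} A∈ A′∈ w∈ w∈′ with ∈-map⁻ (join A) w∈ | ∈-map⁻ (join A′) w∈′
        ... | _ , _ , refl | _ , _ , eq = join-injectiveˡ (bound ab∈) (bound ab∈)
          (∈-descents⁻ a u A∈) (∈-descents⁻ a u A′∈) eq

  length-joinsAt : ∀ ab uv → length (joinsAt ab uv) ≡ ballot² (proj₁ ab) (proj₂ ab) uv
  length-joinsAt (a , b) (u , v) = begin
    length (concatMap (joinsAfter b v) (descents a u))
      ≡⟨ length-concatMap (joinsAfter b v) (descents a u) ⟩
    sum (map (length ∘ joinsAfter b v) (descents a u))
      ≡⟨ sum-const (length ∘ joinsAfter b v) {xs = descents a u}
           (All.tabulate λ _ → trans (length-map _ (descents b v)) (length-descents b v)) ⟩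
    length (descents a u) * ballot b v
      ≡⟨ cong (_* ballot b v) (length-descents a u) ⟩
    ballot a u * ballot b v ∎
    where open ≡-Reasoning

  length-joins : ∀ c m → length (joins c m) ≡ suc c * ballot c m
  length-joins c m = begin
    length (concatMap (joinsOver m) (antidiagonal c))
      ≡⟨ length-concatMap (joinsOver m) (antidiagonal c) ⟩
    sum (map (length ∘ joinsOver m) (antidiagonal c))
      ≡⟨ sum-const (length ∘ joinsOver m) (All.tabulate λ {ab} ab∈ → trans (over ab)
           (cong (λ h → ballot h m) (∈-antidiagonal⁻ c ab∈))) ⟩
    length (antidiagonal c) * ballot c m
      ≡⟨ cong (_* ballot c m) (length-antidiagonal c) ⟩
    suc c * ballot c m ∎
    where
    open ≡-Reasoning
    over : ∀ ab → length (joinsOver m ab) ≡ ballot (proj₁ ab + proj₂ ab) m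
    over (a , b) = begin
      length (concatMap (joinsAt (a , b)) (antidiagonal m))
        ≡⟨ length-concatMap (joinsAt (a , b)) (antidiagonal m) ⟩
      sum (map (length ∘ joinsAt (a , b)) (antidiagonal m))
        ≡⟨ cong sum (map-cong (length-joinsAt (a , b)) (antidiagonal m)) ⟩
      sum (map (ballot² a b) (antidiagonal m))
        ≡⟨ ballot-convolution a b m ⟩
      ballot (a + b) m ∎

-- Lattice points and their position relative to the strip.

+m-+n≡+o : ∀ {m n} o → m ≡ n + o → + m ℤ.- + n ≡ + o
+m-+n≡+o {m} {n} o refl = begin
  + (n + o) ℤ.- + n ≡⟨ ℤ.m-n≡m⊖n (n + o) n ⟩
  (n + o) ℤ.⊖ n     ≡⟨ ℤ.⊖-≥ (m≤m+n n o) ⟩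
  + (n + o ∸ n)     ≡⟨ cong +_ (m+n∸m≡n n o) ⟩
  + o               ∎
  where open ≡-Reasoning

-- No step decreases a coordinate, so a path that has passed the target in either coordinate cannot
-- return.
endpoint-bound : ∀ w {x y x′ y′} → endpoint (+ x , + y) w ≡ (+ x′ , + y′) → x ≤ x′ × y ≤ y′
endpoint-bound []          refl = ≤-refl , ≤-refl
endpoint-bound (right ∷ w) eq   = let x+1≤ , y≤ = endpoint-bound w eq in m+n≤o⇒m≤o _ x+1≤ , y≤
endpoint-bound (up ∷ w)    eq   = let x≤ , y+1≤ = endpoint-bound w eq in x≤ , m+n≤o⇒m≤o _ y+1≤

All-start : ∀ {P : Point → Set} {p} w → All P (points p w) → P p
All-start []      (px ∷ _) = px
All-start (_ ∷ _) (px ∷ _) = px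

-- Here `m` is n - 1, `c` is k - i and `X` is the abscissa kn - i of the target; the equations are
-- additive to avoid truncated subtraction.
module _ {k m i c X : ℕ} (k≡i+c : k ≡ i + c) (k*n≡X+i : k * suc m ≡ X + i) where

  n : ℕ
  n = suc m

  Safe : Point → Set
  Safe p = ¬ Forbidden k n i p

  target≡ : target k n i ≡ (+ X , + n)
  target≡ = cong (_, + n)
    (trans (cong (ℤ._- + i) (sym (ℤ.pos-* k n)))
      (+m-+n≡+o X (trans k*n≡X+i (+-comm X i))))

  d-nonNegative : ∀ {x y} e → k * y ≡ x + e → d k n i (+ x , + y) ≡ + e
  d-nonNegative {x} {y} e eq = trans (cong (ℤ._- + x) (sym (ℤ.pos-* k y))) (+m-+n≡+o e eq)

  d-negative : ∀ {x y} h → x ≡ k * y + suc h → d k n i (+ x , + y) ≡ -[1+ h ]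
  d-negative {x} {y} h eq = begin
    + k ℤ.* + y ℤ.- + x       ≡⟨ cong (ℤ._- + x) (ℤ.pos-* k y) ⟨
    + (k * y) ℤ.- + x         ≡⟨ ℤ.m-n≡m⊖n (k * y) x ⟩
    (k * y) ℤ.⊖ x             ≡⟨ ℤ.⊖-swap (k * y) x ⟩
    ℤ.- (x ℤ.⊖ (k * y))       ≡⟨ cong ℤ.-_ (ℤ.m-n≡m⊖n x (k * y)) ⟨
    ℤ.- (+ x ℤ.- + (k * y))   ≡⟨ cong ℤ.-_ (+m-+n≡+o (suc h) eq) ⟩
    -[1+ h ]                  ∎
    where open ≡-Reasoning

  strip-forbidden : ∀ {x y} e → k * y ≡ x + e → e < i → 0 < y → Forbidden k n i (+ x , + y)
  strip-forbidden {x} {y} e eq e<i 0<y = inj₁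
    ( (λ p≡o → <-irrefl (sym (ℤ.+-injective (,-injectiveʳ p≡o))) 0<y)
    -- At the target d equals i, which contradicts `e<i`.
    , (λ p≡t → let p≡t′ = trans p≡t target≡
                   x≡X = ℤ.+-injective (,-injectiveˡ p≡t′)
                   y≡n = ℤ.+-injective (,-injectiveʳ p≡t′)
               in <-irrefl (+-cancelˡ-≡ x e i
                    (trans (sym eq) (trans (cong (k *_) y≡n) (trans k*n≡X+i (cong (_+ i) (sym x≡X)))))) e<i)
    , subst (ℤ.0ℤ ℤ.≤_) (sym d≡) (ℤ.+≤+ z≤n)
    , subst (ℤ._< + i) (sym d≡) (ℤ.+<+ e<i))
    where d≡ = d-nonNegative {x} {y} e eq

  line-forbidden : ∀ {x y} → k * y ≡ x + i → 0 < y → y < n → Forbidden k n i (+ x , + y)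
  line-forbidden {x} {y} eq 0<y y<n = inj₂ (d-nonNegative {x} {y} i eq , ℤ.+<+ 0<y , ℤ.+<+ y<n)

  above-safe : ∀ {x y} b → k * y ≡ x + (i + suc b) → Safe (+ x , + y)
  above-safe {x} {y} b eq (inj₁ (_ , _ , _ , d<i)) =
    m+n≮m i (suc b) (ℤ.drop‿+<+ (subst (ℤ._< + i) (d-nonNegative {x} {y} _ eq) d<i))
  above-safe {x} {y} b eq (inj₂ (d≡i , _)) =
    m+1+n≢m i (ℤ.+-injective (trans (sym (d-nonNegative {x} {y} _ eq)) d≡i))

  below-safe : ∀ {x y} h → x ≡ k * y + suc h → Safe (+ x , + y)
  below-safe {x} {y} h eq (inj₁ (_ , _ , 0≤d , _)) with subst (ℤ.0ℤ ℤ.≤_) (d-negative {x} {y} h eq) 0≤d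
  ... | ()
  below-safe {x} {y} h eq (inj₂ (d≡i , _)) with trans (sym (d-negative {x} {y} h eq)) d≡i
  ... | ()

  origin-safe : Safe origin
  origin-safe (inj₁ (p≢o , _))          = p≢o refl
  origin-safe (inj₂ (_ , ℤ.+<+ () , _))

  target-safe : Safe (+ X , + n)
  target-safe (inj₁ (_ , p≢t , _)) = p≢t (sym target≡)
  target-safe (inj₂ (_ , _ , n<n)) = <-irrefl refl (ℤ.drop‿+<+ n<n)

  -- Good paths are exactly the joined pairs of descents.

  Completes : ℕ → ℕ → Path → Set
  Completes x y w = endpoint (+ x , + y) w ≡ (+ X , + n) × All Safe (points (+ x , + y) w)

  offset-right : ∀ {x y} b → k * y ≡ x + (i + suc b) → k * y ≡ x + 1 + (i + b)
  offset-right {x} b eq = trans eq (shift x i b)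
    where
    shift : ∀ x i b → x + (i + suc b) ≡ x + 1 + (i + b)
    shift = solve-∀

  offset-up : ∀ {x y} b → k * y ≡ x + (i + suc b) → k * (y + 1) ≡ x + (i + (suc b + k))
  offset-up {x} {y} b eq = trans (expand k y) (trans (cong (_+ k) eq) (shift x i b k))
    where
    expand : ∀ k y → k * (y + 1) ≡ k * y + k
    expand = solve-∀
    shift : ∀ x i b k → x + (i + suc b) + k ≡ x + (i + (suc b + k))
    shift = solve-∀

  on-line : ∀ x → k * n ≡ x + (i + 0) → X ≡ x
  on-line x eq = +-cancelʳ-≡ i X x (trans (sym k*n≡X+i) (trans eq (cong (_+_ x) (+-identityʳ i))))

  -- The height `b` is the excess d - i, lowered by 1 by a right step and raised by k by an up step.
  -- It vanishes only when no up step is left, and that point is the target.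
  upper-sound : ∀ {x y b v w} → Descent k b v w → k * y ≡ x + (i + b) → y + v ≡ n → Completes x y w
  upper-sound {x} {y} stop eq y+0≡n with trans (sym (+-identityʳ y)) y+0≡n
  ... | refl with on-line x eq
  ... | refl = refl , target-safe ∷ []
  upper-sound {x} {y} (right {b} D) eq y+v≡n =
    let end , safe = upper-sound D (offset-right {x} {y} b eq) y+v≡n
    in end , above-safe b eq ∷ safe
  upper-sound {x} {y} (up {b} {v} D) eq y+v≡n =
    let end , safe = upper-sound D (offset-up {x} {y} b eq) (trans (+-assoc y 1 v) y+v≡n)
    in end , above-safe b eq ∷ safe

  -- Reaching d = i with up steps left means a forbidden point of the upper boundary. With none left
  -- the point is the target, and any further step overshoots. While d > i the path cannot stop,
  -- since the target has d = i.
  upper-complete : ∀ {x y} b v w → k * y ≡ x + (i + b) → 0 < y → y + v ≡ n →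
    Completes x y w → Descent k b v w
  upper-complete {x} {y} zero (suc v) w eq 0<y y+v≡n (_ , safe) =
    ⊥-elim (All-start w safe (line-forbidden
      (trans eq (cong (_+_ x) (+-identityʳ i))) 0<y (subst (y <_) y+v≡n (m<m+n y z<s))))
  upper-complete zero zero [] _ _ _ _ = stop
  upper-complete {x} {y} zero zero (right ∷ w) eq 0<y y+0≡n (end , _)
    with trans (sym (+-identityʳ y)) y+0≡n
  ... | refl with on-line x eq
  ... | refl = ⊥-elim (m+1+n≰m x (proj₁ (endpoint-bound w end)))
  upper-complete {x} {y} b zero (up ∷ w) eq 0<y y+0≡n (end , _)
    with trans (sym (+-identityʳ y)) y+0≡n
  ... | refl = ⊥-elim (m+1+n≰m y (proj₂ (endpoint-bound w end)))
  upper-complete {x} {y} (suc b) v [] eq 0<y y+v≡n (refl , _) =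
    ⊥-elim (m+1+n≢m i (sym (+-cancelˡ-≡ x i _ (trans (sym k*n≡X+i) eq))))
  upper-complete {x} {y} (suc b) v (right ∷ w) eq 0<y y+v≡n (end , _ ∷ safe) =
    right (upper-complete b v w (offset-right {x} {y} b eq) 0<y y+v≡n (end , safe))
  upper-complete {x} {y} (suc b) (suc v) (up ∷ w) eq 0<y y+v≡n (end , _ ∷ safe) =
    up (upper-complete (suc b + k) v w
      (offset-up {x} {y} b eq)
      (m≤n⇒m≤n+o 1 0<y)
      (trans (+-assoc y 1 v) y+v≡n) (end , safe))

  -- Height 0 occurs only at the end of a descent, where no up steps remain and the point is the
  -- origin; elsewhere d is negative.
  lower-safe : ∀ {x y a u w} → Descent k a u w → x ≡ k * u + a → y ≡ u → Safe (+ x , + y)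
  lower-safe {a = zero}  stop eq refl with trans eq (trans (+-identityʳ (k * 0)) (*-zeroʳ k))
  ... | refl = origin-safe
  lower-safe {a = suc h} _    eq refl = below-safe h eq

  -- The stored part is walked back towards the origin, while `w` collects the steps already undone.
  -- Undoing a right step lowers the height -d by 1; undoing an up step raises it by k.
  lower-sound : ∀ {x y a u v} → Descent k a u v → x ≡ k * u + a → y ≡ u →
    ∀ w → Completes x y w → Completes 0 0 (v ʳ++ w)
  lower-sound stop eq refl w done with trans eq (trans (+-identityʳ (k * 0)) (*-zeroʳ k))
  ... | refl = done
  lower-sound {u = u} (right {h} D) eq refl w (end , safe)
    with trans eq (trans (cong (_+_ (k * u)) (+-comm 1 h)) (sym (+-assoc (k * u) h 1)))
  ... | refl = lower-sound D refl refl (right ∷ w) (end , lower-safe D refl refl ∷ safe)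
  lower-sound {x} (up {h} {u} D) eq refl w done =
    lower-sound D (trans eq (shift k u h)) refl (up ∷ w)
      (proj₁ done′ , lower-safe D (trans eq (shift k u h)) refl ∷ proj₂ done′)
    where
    shift : ∀ k u h → k * suc u + suc h ≡ k * u + (suc h + k)
    shift = solve-∀
    done′ : Completes x (u + 1) w
    done′ = subst (λ y → Completes x y w) (+-comm 1 u) done

  joined-sound : ∀ {w} → Joined k c m w → Completes 0 0 w
  joined-sound (joined {a} {b} {u} {v} {A} {B} a+b≡c u+v≡m D D′) =
    lower-sound D refl refl (up ∷ B) (proj₁ done , lower-safe D refl refl ∷ proj₂ done)
    where
    shift : ∀ k u a b i → k * u + (i + (a + b)) ≡ k * u + a + (i + b)
    shift = solve-∀
    -- The crossing takes d from -a to k - a, which is i + b because a + b = k - i.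
    done : Completes (k * u + a) (u + 1) B
    done = upper-sound D′
      (begin
        k * (u + 1)                ≡⟨ cong (k *_) (+-comm u 1) ⟩
        k * suc u                  ≡⟨ *-suc k u ⟩
        k + k * u                  ≡⟨ +-comm k (k * u) ⟩
        k * u + k                  ≡⟨ cong (_+_ (k * u)) (trans k≡i+c (cong (_+_ i) (sym a+b≡c))) ⟩
        k * u + (i + (a + b))      ≡⟨ shift k u a b i ⟩
        k * u + a + (i + b)        ∎)
      (trans (+-assoc u 1 v) (trans (+-suc u v) (cong suc u+v≡m)))
      where open ≡-Reasoning

  -- The path is read forwards, with the steps already taken kept in reverse as a descent, until an
  -- up step makes d nonnegative.
  lower-complete : ∀ {x y a u v} → Descent k a u v → x ≡ k * u + a → y ≡ u →
    ∀ w → Completes x y w → Joined k c m (v ʳ++ w)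
  -- Stopping at the target would force `a` = 0, but no descent from height 0 has `n` > 0 up steps.
  lower-complete {x} {a = a} D eq refl [] (refl , _) with m+n≡0⇒m≡0 a (+-cancelˡ-≡ (k * n) (a + i) 0
    (trans (sym (+-assoc (k * n) a i)) (trans (cong (_+ i) (sym eq)) (trans (sym k*n≡X+i) (sym (+-identityʳ _))))))
  ... | refl with () ← D
  lower-complete {u = u} {v = v} D eq refl (right ∷ w) (end , _ ∷ safe) =
    lower-complete (right D)
      (trans (cong (_+ 1) eq) (trans (+-assoc (k * u) _ 1) (cong (_+_ (k * u)) (+-comm _ 1))))
      refl w (end , safe)
  lower-complete {x} {a = a} {u} {v} D eq refl (up ∷ w) (end , _ ∷ safe) with a ≤? k
  -- From a height above `k` the up step still leaves d negative, so it belongs to the first part.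
  ... | no a≰k with m≤n⇒∃[o]m+o≡n (≰⇒> a≰k)
  ...   | h , refl = lower-complete (up (subst (λ a → Descent k a u v) (cong suc (+-comm k h)) D))
          (trans eq (shift k u h)) (+-comm u 1) w (end , safe)
    where
    shift : ∀ k u h → k * u + suc (k + h) ≡ k * suc u + suc h
    shift = solve-∀
  lower-complete {x} {a = a} {u} {v} D eq refl (up ∷ w) (end , _ ∷ safe) | yes a≤k
    with m≤n⇒∃[o]m+o≡n a≤k
  -- The value of d after the up step is `e` = k - a. If e < i the path lands in the strip;
  -- otherwise this step is the crossing, with b = e - i.
  ... | e , a+e≡k = after-jump (i ≤? e)
    where
    after : k * (u + 1) ≡ x + e
    after = begin
      k * (u + 1)     ≡⟨ cong (k *_) (+-comm u 1) ⟩
      k * suc u       ≡⟨ *-suc k u ⟩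
      k + k * u       ≡⟨ +-comm k (k * u) ⟩
      k * u + k       ≡⟨ cong (_+_ (k * u)) a+e≡k ⟨
      k * u + (a + e) ≡⟨ +-assoc (k * u) a e ⟨
      k * u + a + e   ≡⟨ cong (_+ e) eq ⟨
      x + e           ∎
      where open ≡-Reasoning

    after-jump : Dec (i ≤ e) → Joined k c m (v ʳ++ up ∷ w)
    after-jump (no i≰e) =
      ⊥-elim (All-start w safe (strip-forbidden e after (≰⇒> i≰e) (m≤n+m 1 u)))
    after-jump (yes i≤e) with m≤n⇒∃[o]m+o≡n i≤e | m≤n⇒∃[o]m+o≡n (proj₂ (endpoint-bound w end))
    ... | b , i+b≡e | v′ , u+1+v′≡n =
      joined a+b≡c (suc-injective (trans (sym (+-suc u v′)) (trans (sym (+-assoc u 1 v′)) u+1+v′≡n))) D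
        (upper-complete b v′ w (trans after (cong (_+_ x) (sym i+b≡e))) (m≤n+m 1 u) u+1+v′≡n (end , safe))
      where
      a+b≡c : a + b ≡ c
      a+b≡c = +-cancelˡ-≡ i (a + b) c (begin
        i + (a + b) ≡⟨ swap i a b ⟩
        a + (i + b) ≡⟨ cong (_+_ a) i+b≡e ⟩
        a + e       ≡⟨ a+e≡k ⟩
        k           ≡⟨ k≡i+c ⟩
        i + c       ∎)
        where
        open ≡-Reasoning
        swap : ∀ i a b → i + (a + b) ≡ a + (i + b)
        swap = solve-∀

  joined-complete : ∀ {w} → Completes 0 0 w → Joined k c m w
  joined-complete {w} = lower-complete stop (trans (sym (*-zeroʳ k)) (sym (+-identityʳ _))) refl w

  hasCount : HasCount (GoodPath k n i) (suc c * ballot k c m)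
  hasCount = joins k c m
    , joins-unique k m (subst (c ≤_) (sym k≡i+c) (m≤n+m c i))
    , (λ w → mk⇔
        (λ w∈ → let end , safe = joined-sound (∈-joins⁻ k c m w∈) in trans end (sym target≡) , safe)
        (λ (end , safe) → ∈-joins⁺ k (joined-complete (trans end target≡ , safe))))
    , length-joins k c m

-- Evaluation of the count as a rational number.

/1≡/*/1 : ∀ N p q D .{{_ : NonZero D}} → N * D ≡ p * q → + N / 1 ≡ (+ p / D) ℚ.* (+ q / 1)
/1≡/*/1 N p q (suc D) eq = ℚ.toℚᵘ-injective (begin-equality
  ℚ.toℚᵘ (+ N / 1)                              ≃⟨ ℚ.toℚᵘ-fromℚᵘ (mkℚᵘ (+ N) 0) ⟩
  mkℚᵘ (+ N) 0                                  ≃⟨ *≡* cross ⟩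
  mkℚᵘ (+ p) D ℚᵘ.* mkℚᵘ (+ q) 0                ≃⟨ ℚᵘ.*-cong (ℚ.toℚᵘ-fromℚᵘ (mkℚᵘ (+ p) D)) (ℚ.toℚᵘ-fromℚᵘ (mkℚᵘ (+ q) 0)) ⟨
  ℚ.toℚᵘ (+ p / suc D) ℚᵘ.* ℚ.toℚᵘ (+ q / 1)    ≃⟨ ℚ.toℚᵘ-homo-* (+ p / suc D) (+ q / 1) ⟨
  ℚ.toℚᵘ ((+ p / suc D) ℚ.* (+ q / 1))          ∎)
  where
  open ℚᵘ.≤-Reasoning
  -- Equality of unnormalised fractions is cross-multiplication; `mkℚᵘ` stores the denominator minus
  -- one.
  cross : + N ℤ.* (+ suc (D * 1)) ≡ (+ p ℤ.* + q) ℤ.* + 1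
  cross = trans (cong (λ t → + N ℤ.* + suc t) (*-identityʳ D))
    (trans (sym (ℤ.pos-* N (suc D)))
      (trans (cong +_ eq) (trans (ℤ.pos-* p q) (sym (ℤ.*-identityʳ _)))))

-- The two factors of the denominator are `L` and `suc L`, where `L` is the length of a descent from
-- height `c` with `m` up steps. The ballot formula absorbs `L`; the absorption identity absorbs
-- `suc L` and turns L choose m into the binomial of the statement.
count-closed : ∀ i c m → let k = i + c ; n = suc m in
  suc c * ballot k c m * denominator k n i ≡ n * (k ∸ i) * (k + 1 ∸ i) * ((k * n + n ∸ i) C n)
count-closed i c m = begin
  suc c * ballot k c m * denominator k (suc m) i
    ≡⟨ cong (λ t → suc c * ballot k c m * t) (cong₂ _*_ total-1 total) ⟩
  suc c * ballot k c m * (L * suc L)       ≡⟨ regroup₁ c (ballot k c m) L ⟩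
  suc c * (ballot k c m * L) * suc L       ≡⟨ cong (λ t → suc c * t * suc L) (ballot-closed k c m) ⟩
  suc c * (c * (L C m)) * suc L            ≡⟨ regroup₂ c (L C m) L ⟩
  suc c * c * (suc L * (L C m))            ≡⟨ cong (suc c * c *_) (C-absorb L m) ⟨
  suc c * c * (suc m * (suc L C suc m))    ≡⟨ regroup₃ c m (suc L C suc m) ⟩
  suc m * c * suc c * (suc L C suc m)
    ≡⟨ cong₂ _*_ (cong₂ (λ s t → suc m * s * t) numerator₁ numerator₂) (cong (_C suc m) total) ⟨
  suc m * (k ∸ i) * (k + 1 ∸ i) * ((k * suc m + suc m ∸ i) C suc m) ∎
  where
  open ≡-Reasoning
  k L : ℕ
  k = i + c
  L = suc k * m + c
  expand : ∀ i c m → (i + c) * suc m + suc m ≡ i + suc (suc (i + c) * m + c)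
  expand = solve-∀
  numerator₁ : k ∸ i ≡ c
  numerator₁ = m+n∸m≡n i c
  numerator₂ : k + 1 ∸ i ≡ suc c
  numerator₂ = trans (cong (_∸ i) (trans (+-assoc i c 1) (cong (_+_ i) (+-comm c 1)))) (m+n∸m≡n i (suc c))
  total : k * suc m + suc m ∸ i ≡ suc L
  total = trans (cong (_∸ i) (expand i c m)) (m+n∸m≡n i (suc L))
  total-1 : k * suc m + suc m ∸ 1 ∸ i ≡ L
  total-1 = trans (cong (λ t → t ∸ 1 ∸ i) (trans (expand i c m) (+-suc i L))) (m+n∸m≡n i L)
  regroup₁ : ∀ c b l → suc c * b * (l * suc l) ≡ suc c * (b * l) * suc l
  regroup₁ = solve-∀
  regroup₂ : ∀ c x l → suc c * (c * x) * suc l ≡ suc c * c * (suc l * x)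
  regroup₂ = solve-∀
  regroup₃ : ∀ c m x → suc c * c * (suc m * x) ≡ suc m * c * suc c * x
  regroup₃ = solve-∀

theorem7 : (k n i : ℕ) (0<k : 0 < k) (0<n : 0 < n) (i<k : i < k) →
    ∃[ N ] HasCount (GoodPath k n i) N ×
    + N / 1 ≡ _/_ (+ (n * (k ∸ i) * (k + 1 ∸ i))) (denominator k n i) {{denominator-nonZero k n i 0<k 0<n i<k}} ℚ.* (+ ((k * n + n ∸ i) C n) / 1)
theorem7 k (suc m) i 0<k 0<n i<k with m≤n⇒∃[o]m+o≡n (<⇒≤ i<k)
... | c , refl = suc c * ballot k c m
  -- The abscissa `X` becomes the truncated difference of kn and i, which is exact since i < k and k
  -- is at most kn.
  , hasCount refl (sym (m∸n+n≡m (≤-trans (<⇒≤ i<k) (m≤m*n k (suc m)))))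
  , /1≡/*/1 (suc c * ballot k c m) (suc m * (k ∸ i) * (k + 1 ∸ i)) ((k * suc m + suc m ∸ i) C suc m)
      (denominator k (suc m) i) {{denominator-nonZero k (suc m) i 0<k 0<n i<k}}
      (count-closed i c m)
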